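{- Let $n$ be a positive integer, $m$ a non-negative integer and $p$ an integer. In each identity below either all upper signs or all lower signs are taken. (i) If $p$, $m$ and $n$ are all odd, then $$\sum_{k=0}^n(-1)^{n-k}\frac{n}{n+k}\binom{n+k}{n-k}\bigl(2\pm\sqrt5\,F_{pm}\bigr)^k=\pm\frac{\sqrt5}{2}F_{pmn}.$$ (ii) If $p$ is odd and $m$ is even, then $$\sum_{k=0}^n(-1)^{n-k}\frac{n}{n+k}\binom{n+k}{n-k}\bigl(2\pm L_{pm}\bigr)^k=\frac{(\pm1)^n}{2}L_{pmn}.$$ (iii) If $p$ is even, then $$\sum_{k=0}^n(-1)^{n-k}\frac{n}{n+k}\binom{n+k}{n-k}\bigl(2\pm L_{pm}\bigr)^k=\frac{(\pm1)^n}{2}L_{pmn}.$$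
   Context: $F_n$ and $L_n$ ($n\in\mathbb{Z}$) are the Fibonacci and Lucas numbers: $F_0=0$, $F_1=1$, $F_n=F_{n-1}+F_{n-2}$; $L_0=2$, $L_1=1$, $L_n=L_{n-1}+L_{n-2}$, extended to negative indices by $F_{ -n}=(-1)^{n-1}F_n$, $L_{ -n}=(-1)^nL_n$. The convention $0^0=1$ is used. -}

module Defs where

open import Algebra.Bundles using (RawRing)
open import Data.Fin.Base using (toℕ)
open import Data.Integer.Base as ℤ using (ℤ; +_; -[1+_]; -1ℤ)
open import Data.Nat.Base as ℕ using (ℕ; zero; suc; NonZero)
open import Data.Nat.Combinatorics using (_C_)
open import Data.Rational.Base as ℚ using (ℚ; 0ℚ; 1ℚ)
open import Data.Sign.Base as Sign using (Sign)
open import Level using (0ℓ)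
open import Relation.Binary.PropositionalEquality.Core using (_≡_; refl)
import Algebra.Definitions.RawSemiring as RawSemiringDefs

fib : ℕ → ℕ
fib 0             = 0
fib 1             = 1
fib (suc (suc n)) = fib (suc n) ℕ.+ fib n

lucas : ℕ → ℕ
lucas 0             = 2
lucas 1             = 1
lucas (suc (suc n)) = lucas (suc n) ℕ.+ lucas n

-- -[1+ n ] denotes -(1 + n), so the exponents below are those of
-- F₋ⱼ = (-1)ʲ⁻¹ Fⱼ and L₋ⱼ = (-1)ʲ Lⱼ at j = 1 + n.
F : ℤ → ℤ
F (+ n)    = + fib n
F -[1+ n ] = -1ℤ ℤ.^ n ℤ.* + fib (suc n)

L : ℤ → ℤ
L (+ n)    = + lucas n
L -[1+ n ] = -1ℤ ℤ.^ suc n ℤ.* + lucas (suc n)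

-- The field ℚ(√5): a +√5 b stands for the real number a + b√5.  Since √5 is
-- irrational, two such numbers are equal exactly when their components are.
infix 5 _+√5_
record ℚ√5 : Set where
  constructor _+√5_
  field
    rational   : ℚ
    irrational : ℚ

infixl 6 _+_
infixl 7 _*_
infix  8 -_

_+_ : ℚ√5 → ℚ√5 → ℚ√5
(a +√5 b) + (c +√5 d) = (a ℚ.+ c) +√5 (b ℚ.+ d)

_*_ : ℚ√5 → ℚ√5 → ℚ√5
(a +√5 b) * (c +√5 d) =
  (a ℚ.* c ℚ.+ (+ 5 ℚ./ 1) ℚ.* (b ℚ.* d)) +√5 (a ℚ.* d ℚ.+ b ℚ.* c)

-_ : ℚ√5 → ℚ√5
- (a +√5 b) = (ℚ.- a) +√5 (ℚ.- b)

fromℚ : ℚ → ℚ√5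
fromℚ q = q +√5 0ℚ

fromℤ : ℤ → ℚ√5
fromℤ i = fromℚ (i ℚ./ 1)

√5 : ℚ√5
√5 = 0ℚ +√5 1ℚ

√5*√5≡5 : √5 * √5 ≡ fromℤ (+ 5)
√5*√5≡5 = refl

ℚ√5-rawRing : RawRing 0ℓ 0ℓ
ℚ√5-rawRing = record
  { Carrier = ℚ√5
  ; _≈_     = _≡_
  ; _+_     = _+_
  ; _*_     = _*_
  ; -_      = -_
  ; 0#      = fromℚ 0ℚ
  ; 1#      = fromℚ 1ℚ
  }

open RawRing ℚ√5-rawRing public using (1#)

-- Here x ^ 0 is 1# for every x, including x = 0.
open RawSemiringDefs (RawRing.rawSemiring ℚ√5-rawRing) public using (_^_; sum)

-- The sign s selects the upper (+) or lower (-) alternative: ±[ s ] x is ±x.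
infix 8 ±[_]_
±[_]_ : Sign → ℚ√5 → ℚ√5
±[ Sign.+ ] x = x
±[ Sign.- ] x = - x

n+k≢0 : ∀ n k .{{_ : NonZero n}} → NonZero (n ℕ.+ k)
n+k≢0 (suc _) _ = _

∑[k≤_] : ℕ → (ℕ → ℚ√5) → ℚ√5
∑[k≤ n ] f = sum {suc n} (λ k → f (toℕ k))

-- ∑ₖ₌₀ⁿ (-1)ⁿ⁻ᵏ n/(n+k) binom(n+k, n-k) xᵏ; as k ≤ n, the truncated
-- subtraction n ∸ k is exact.
S : (n : ℕ) .{{_ : NonZero n}} → ℚ√5 → ℚ√5
S n x = ∑[k≤ n ] λ k →
  (- 1#) ^ (n ℕ.∸ k)
    * fromℚ (ℚ._/_ (+ n) (n ℕ.+ k) {{n+k≢0 n k}})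
    * fromℤ (+ ((n ℕ.+ k) C (n ℕ.∸ k)))
    * x ^ k

-- If tu = 1, then twice the sum at x = 2 + t + u is tⁿ + uⁿ.  Indeed, twice the
-- sum is Aₙ - Aₙ₋₁ for the signed Morgan-Voyce polynomials
--   Aₙ = ∑ₖ (-1)ⁿ⁻ᵏ binom(n+k, n-k) xᵏ,   Bₙ = ∑ₖ (-1)ⁿ⁻ᵏ binom(n+k+1, n-k) xᵏ,
-- for which Pascal's rule gives Aₙ₊₁ = xBₙ - Aₙ and Bₙ₊₁ = Aₙ₊₁ - Bₙ, hence
-- Aₙ₊₂ = (x - 2)Aₙ₊₁ - Aₙ.  The three identities are the cases t = ±αʲ and
-- u = (±1)(-1)ʲ βʲ, where j = |pm|, α = (1 + √5)/2 and β = (1 - √5)/2.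
module Submission where

open import Defs
open import Algebra.Bundles using (CommutativeRing)
open import Algebra.Consequences.Propositional
  using (comm∧idˡ⇒id; comm∧invˡ⇒inv; comm∧distrˡ⇒distrʳ)
import Algebra.Properties.CommutativeMonoid.Sum as MonoidSum
import Algebra.Properties.CommutativeSemiring.Exp as CommutativeSemiringExp
import Algebra.Properties.Semiring.Exp as SemiringExp
import Algebra.Properties.Semiring.Sum as SemiringSum
import Algebra.Solver.Ring.AlmostCommutativeRing as ACR
import Algebra.Solver.Ring.Simple as RingSolver
open import Data.Empty using (⊥-elim)
open import Data.Fin.Base using (toℕ)
open import Data.Integer.Base as ℤ using (ℤ; +_; -[1+_]; -1ℤ)
open import Data.Integer.Divisibility as ℤ∣ using ()
import Data.Integer.Properties as ℤ
open import Data.Nat.Base as ℕ using (ℕ; zero; suc; NonZero)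
open import Data.Nat.Combinatorics using (_C_; nC1≡n; nCn≡1; nCk+nC[k+1]≡[n+1]C[k+1])
open import Data.Nat.Divisibility as ℕ∣ using (divides)
open import Data.Nat.Primality using (euclidsLemma; prime[2])
import Data.Nat.Properties as ℕ
import Data.Nat.Solver as ℕSolver
open import Data.Product.Base using (_×_; _,_; ∃-syntax)
open import Data.Rational.Base as ℚ using (½; 0ℚ; 1ℚ; toℚᵘ)
import Data.Rational.Properties as ℚ
import Data.Rational.Solver as ℚSolver
open import Data.Rational.Unnormalised.Base as ℚᵘ using (mkℚᵘ; *≡*)
import Data.Rational.Unnormalised.Properties as ℚᵘ
open import Data.Sign.Base as Sign using (Sign)
open import Data.Sum.Base using ([_,_]′)
open import Function.Base using (_∘_)
open import Level using (0ℓ)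
open import Relation.Binary.Definitions using (DecidableEquality)
open import Relation.Binary.PropositionalEquality
open import Relation.Binary.PropositionalEquality.Algebra using (isMagma)
open import Relation.Nullary using (¬_)
open import Relation.Nullary.Decidable using (map′; _×-dec_)

open ≡-Reasoning
open ℚᵘ.≤-Reasoning using (begin-equality_; step-≃-⟩; step-≃-⟨)
  renaming (_∎ to _□)

-- The ring ℚ(√5)

0# : ℚ√5
0# = fromℚ 0ℚ

module _ where
  open ℚSolver.+-*-Solver

  *-assoc : ∀ x y z → (x * y) * z ≡ x * (y * z)
  *-assoc (a +√5 b) (c +√5 d) (e +√5 f) = cong₂ _+√5_
    -- The constant 5 is generalised to a variable `k`: the polynomial identity holds for a square
    -- root of any rational, so the solver need not compute with 5.
    (solve 7 (λ k a b c d e f →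
        (a :* c :+ k :* (b :* d)) :* e :+ k :* ((a :* d :+ b :* c) :* f)
        := a :* (c :* e :+ k :* (d :* f)) :+ k :* (b :* (c :* f :+ d :* e)))
      refl (+ 5 ℚ./ 1) a b c d e f)
    (solve 7 (λ k a b c d e f →
        (a :* c :+ k :* (b :* d)) :* f :+ (a :* d :+ b :* c) :* e
        := a :* (c :* f :+ d :* e) :+ b :* (c :* e :+ k :* (d :* f)))
      refl (+ 5 ℚ./ 1) a b c d e f)

  *-comm : ∀ x y → x * y ≡ y * x
  *-comm (a +√5 b) (c +√5 d) = cong₂ _+√5_
    (solve 5 (λ k a b c d → a :* c :+ k :* (b :* d) := c :* a :+ k :* (d :* b))
      refl (+ 5 ℚ./ 1) a b c d)
    (solve 4 (λ a b c d → a :* d :+ b :* c := c :* b :+ d :* a) refl a b c d)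

  *-distribˡ-+ : ∀ x y z → x * (y + z) ≡ x * y + x * z
  *-distribˡ-+ (a +√5 b) (c +√5 d) (e +√5 f) = cong₂ _+√5_
    (solve 7 (λ k a b c d e f →
        a :* (c :+ e) :+ k :* (b :* (d :+ f))
        := (a :* c :+ k :* (b :* d)) :+ (a :* e :+ k :* (b :* f)))
      refl (+ 5 ℚ./ 1) a b c d e f)
    (solve 6 (λ a b c d e f →
        a :* (d :+ f) :+ b :* (c :+ e) := (a :* d :+ b :* c) :+ (a :* f :+ b :* e))
      refl a b c d e f)

  *-identityˡ : ∀ x → 1# * x ≡ x
  *-identityˡ (a +√5 b) = cong₂ _+√5_
    (solve 2 (λ a b → con 1ℚ :* a :+ con (+ 5 ℚ./ 1) :* (con 0ℚ :* b) := a) refl a b)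
    (solve 2 (λ a b → con 1ℚ :* b :+ con 0ℚ :* a := b) refl a b)

ℚ√5-commutativeRing : CommutativeRing 0ℓ 0ℓ
ℚ√5-commutativeRing = record
  { Carrier = ℚ√5
  ; _≈_     = _≡_
  ; _+_     = _+_
  ; _*_     = _*_
  ; -_      = -_
  ; 0#      = 0#
  ; 1#      = 1#
  ; isCommutativeRing = record
    { isRing = record
      { +-isAbelianGroup = record
        { isGroup = record
          { isMonoid = record
            { isSemigroup = record
              { isMagma = isMagma _+_
              ; assoc = λ (a +√5 b) (c +√5 d) (e +√5 f) →
                  cong₂ _+√5_ (ℚ.+-assoc a c e) (ℚ.+-assoc b d f)
              }
            ; identity = comm∧idˡ⇒id +-comm
                (λ (a +√5 b) → cong₂ _+√5_ (ℚ.+-identityˡ a) (ℚ.+-identityˡ b))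
            }
          ; inverse = comm∧invˡ⇒inv +-comm
              (λ (a +√5 b) → cong₂ _+√5_ (ℚ.+-inverseˡ a) (ℚ.+-inverseˡ b))
          ; ⁻¹-cong = cong -_
          }
        ; comm = +-comm
        }
      ; *-cong = cong₂ _*_
      ; *-assoc = *-assoc
      ; *-identity = comm∧idˡ⇒id *-comm *-identityˡ
      ; distrib = *-distribˡ-+ , comm∧distrˡ⇒distrʳ *-comm *-distribˡ-+
      }
    ; *-comm = *-comm
    }
  }
  where
  +-comm : ∀ x y → x + y ≡ y + x
  +-comm (a +√5 b) (c +√5 d) = cong₂ _+√5_ (ℚ.+-comm a c) (ℚ.+-comm b d)

-- Decidable equality lets the ring solver take elements of the field itself as coefficients, so
-- relations between constants such as `α` and `β` are settled by evaluation.
_≟_ : DecidableEquality ℚ√5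
(a +√5 b) ≟ (c +√5 d) = map′ (λ (e , f) → cong₂ _+√5_ e f)
  (λ e → cong ℚ√5.rational e , cong ℚ√5.irrational e) (a ℚ.≟ c ×-dec b ℚ.≟ d)

module ℚ√5-Solver =
  RingSolver (ACR.fromCommutativeRing ℚ√5-commutativeRing) _≟_

-- Fractions and integers inside ℚ(√5)

toℚᵘ-/ : ∀ i d .{{_ : NonZero d}} → toℚᵘ (i ℚ./ d) ℚᵘ.≃ (i ℚᵘ./ d)
toℚᵘ-/ i (suc d) = ℚ.toℚᵘ-fromℚᵘ (mkℚᵘ i d)

fromℚ-* : ∀ p q → fromℚ (p ℚ.* q) ≡ fromℚ p * fromℚ q
fromℚ-* p q = cong₂ _+√5_
  (solve 2 (λ p q → p :* q := p :* q :+ con (+ 5 ℚ./ 1) :* (con 0ℚ :* con 0ℚ)) refl p q)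
  (solve 2 (λ p q → con 0ℚ := p :* con 0ℚ :+ con 0ℚ :* q) refl p q)
  where open ℚSolver.+-*-Solver

fromℤ-+ : ∀ i j → fromℤ (i ℤ.+ j) ≡ fromℤ i + fromℤ j
-- Unnormalised rationals carry no gcd, so there the claim is an equation between cross products of
-- integers.
fromℤ-+ i j = cong (_+√5 0ℚ) (ℚ.toℚᵘ-injective (begin-equality
  toℚᵘ ((i ℤ.+ j) ℚ./ 1)                ≃⟨ toℚᵘ-/ (i ℤ.+ j) 1 ⟩
  (i ℤ.+ j) ℚᵘ./ 1                      ≃⟨ *≡* (cong (ℤ._* + 1) (sym (cong₂ ℤ._+_ (ℤ.*-identityʳ i) (ℤ.*-identityʳ j)))) ⟩
  i ℚᵘ./ 1 ℚᵘ.+ j ℚᵘ./ 1                ≃⟨ ℚᵘ.+-cong (toℚᵘ-/ i 1) (toℚᵘ-/ j 1) ⟨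
  toℚᵘ (i ℚ./ 1) ℚᵘ.+ toℚᵘ (j ℚ./ 1)    ≃⟨ ℚ.toℚᵘ-homo-+ (i ℚ./ 1) (j ℚ./ 1) ⟨
  toℚᵘ (i ℚ./ 1 ℚ.+ j ℚ./ 1)            □))

-- The hypothesis is (a/d)b = c/2 with denominators cleared. This serves to replace the weight
-- n/(n+k) times a binomial coefficient by half an integer.
fromℚ-½ : ∀ a b c d .{{_ : NonZero d}} → 2 ℕ.* (a ℕ.* b) ≡ c ℕ.* d →
  fromℚ (+ a ℚ./ d) * fromℤ (+ b) ≡ fromℚ ½ * fromℤ (+ c)
fromℚ-½ a b c d@(suc _) eq = trans (sym (fromℚ-* (+ a ℚ./ d) (+ b ℚ./ 1)))
  (trans (cong fromℚ (ℚ.toℚᵘ-injective ≃)) (fromℚ-* ½ (+ c ℚ./ 1)))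
  where
  cross : (+ a ℤ.* + b) ℤ.* + 2 ≡ (+ 1 ℤ.* + c) ℤ.* + (d ℕ.* 1)
  cross = begin
    (+ a ℤ.* + b) ℤ.* + 2            ≡⟨ cong (ℤ._* + 2) (ℤ.pos-* a b) ⟨
    + (a ℕ.* b) ℤ.* + 2              ≡⟨ ℤ.pos-* (a ℕ.* b) 2 ⟨
    + (a ℕ.* b ℕ.* 2)                ≡⟨ cong +_ (trans (ℕ.*-comm (a ℕ.* b) 2) eq) ⟩
    + (c ℕ.* d)                      ≡⟨ ℤ.pos-* c d ⟩
    + c ℤ.* + d                      ≡⟨ cong₂ (λ i e → i ℤ.* + e) (sym (ℤ.*-identityˡ (+ c))) (sym (ℕ.*-identityʳ d)) ⟩
    (+ 1 ℤ.* + c) ℤ.* + (d ℕ.* 1)    ∎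
  ≃ : toℚᵘ ((+ a ℚ./ d) ℚ.* (+ b ℚ./ 1)) ℚᵘ.≃ toℚᵘ (½ ℚ.* (+ c ℚ./ 1))
  ≃ = begin-equality
    toℚᵘ ((+ a ℚ./ d) ℚ.* (+ b ℚ./ 1))       ≃⟨ ℚ.toℚᵘ-homo-* (+ a ℚ./ d) (+ b ℚ./ 1) ⟩
    toℚᵘ (+ a ℚ./ d) ℚᵘ.* toℚᵘ (+ b ℚ./ 1)   ≃⟨ ℚᵘ.*-cong (toℚᵘ-/ (+ a) d) (toℚᵘ-/ (+ b) 1) ⟩
    (+ a ℚᵘ./ d) ℚᵘ.* (+ b ℚᵘ./ 1)           ≃⟨ *≡* cross ⟩
    toℚᵘ ½ ℚᵘ.* (+ c ℚᵘ./ 1)                 ≃⟨ ℚᵘ.*-congˡ {toℚᵘ ½} (toℚᵘ-/ (+ c) 1) ⟨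
    toℚᵘ ½ ℚᵘ.* toℚᵘ (+ c ℚ./ 1)             ≃⟨ ℚ.toℚᵘ-homo-* ½ (+ c ℚ./ 1) ⟨
    toℚᵘ (½ ℚ.* (+ c ℚ./ 1))                 □

fromℕ : ℕ → ℚ√5
fromℕ n = fromℤ (+ n)

-- The absorption identity for binomial coefficients

[k+1]*[n+1]C[k+1]≡[n+1]*nCk : ∀ n k → suc k ℕ.* (suc n C suc k) ≡ suc n ℕ.* (n C k)
[k+1]*[n+1]C[k+1]≡[n+1]*nCk zero zero = refl
[k+1]*[n+1]C[k+1]≡[n+1]*nCk zero (suc k) = ℕ.*-zeroʳ (suc (suc k))
[k+1]*[n+1]C[k+1]≡[n+1]*nCk (suc n) zero =
  trans (ℕ.*-identityˡ _) (trans (nC1≡n (suc (suc n))) (sym (ℕ.*-identityʳ (suc (suc n)))))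
[k+1]*[n+1]C[k+1]≡[n+1]*nCk (suc n) (suc k) = begin
  suc (suc k) ℕ.* (suc (suc n) C suc (suc k))
    ≡⟨ cong (suc (suc k) ℕ.*_) (nCk+nC[k+1]≡[n+1]C[k+1] (suc n) (suc k)) ⟨
  suc (suc k) ℕ.* (p ℕ.+ q)
    -- After Pascal's rule one copy of `p` is set aside; the multiples that remain are exactly those
    -- to which the induction hypothesis applies, and Pascal's rule one row down merges them into
    -- `suc n` further copies of `p`.
    ≡⟨ solve 3 (λ k p q → (con 2 :+ k) :* (p :+ q) := p :+ ((con 1 :+ k) :* p :+ (con 2 :+ k) :* q)) refl k p q ⟩
  p ℕ.+ (suc k ℕ.* p ℕ.+ suc (suc k) ℕ.* q)
    ≡⟨ cong (p ℕ.+_) (cong₂ ℕ._+_ ([k+1]*[n+1]C[k+1]≡[n+1]*nCk n k) ([k+1]*[n+1]C[k+1]≡[n+1]*nCk n (suc k))) ⟩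
  p ℕ.+ (suc n ℕ.* (n C k) ℕ.+ suc n ℕ.* (n C suc k))
    ≡⟨ cong (p ℕ.+_) (ℕ.*-distribˡ-+ (suc n) (n C k) (n C suc k)) ⟨
  p ℕ.+ suc n ℕ.* (n C k ℕ.+ n C suc k)
    ≡⟨ cong (λ r → p ℕ.+ suc n ℕ.* r) (nCk+nC[k+1]≡[n+1]C[k+1] n k) ⟩
  suc (suc n) ℕ.* p ∎
  where
  open ℕSolver.+-*-Solver
  p = suc n C suc k
  q = suc n C suc (suc k)

-- Morgan-Voyce polynomials

-- With n = i + k, the coefficients of (-1)ⁱ xᵏ in Aₙ, in Bₙ and, for n > 0, in
-- twice the sum.
a b d : ℕ → ℕ → ℕ
a i k = (i ℕ.+ k ℕ.+ k) C i
b i k = suc (i ℕ.+ k ℕ.+ k) C i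
d zero    k = 1
d (suc i) k = a (suc i) k ℕ.+ a i k

-- Pascal's rule behind Bₙ₊₁ = Aₙ₊₁ - Bₙ. The last summand has first index `i` instead of `suc i`,
-- so its sign (-1)ⁱ is the opposite one, whence the minus.
b-pascal : ∀ i k → b (suc i) k ≡ a (suc i) k ℕ.+ b i k
b-pascal i k = trans (sym (nCk+nC[k+1]≡[n+1]C[k+1] _ i)) (ℕ.+-comm (b i k) _)

-- Pascal's rule behind Aₙ₊₁ = xBₙ - Aₙ: the drop from `suc k` to `k` in the first summand is the
-- factor x. The constant terms, where there is no such `k`, are left to `aᵢ₀≡1`.
a-pascal : ∀ i k → a (suc i) (suc k) ≡ b (suc i) k ℕ.+ a i (suc k)
a-pascal i k rewrite ℕ.+-suc i k | ℕ.+-suc (i ℕ.+ k) k =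
  trans (sym (nCk+nC[k+1]≡[n+1]C[k+1] _ i)) (ℕ.+-comm (suc (suc (i ℕ.+ k ℕ.+ k)) C i) _)

aᵢ₀≡1 : ∀ i → a i 0 ≡ 1
aᵢ₀≡1 i rewrite ℕ.+-identityʳ i | ℕ.+-identityʳ i = nCn≡1 i

module _ where
  open ℕSolver.+-*-Solver

  -- With n = i + k this says that 2n/(n+k) binom(n+k, n-k) is the integer `d i k`. For i > 0 write
  -- 2n = (n+k) + i: the first part keeps the binomial coefficient, and absorption turns i times it
  -- into n+k times its neighbour.
  d-absorb : ∀ i k → 2 ℕ.* ((i ℕ.+ k) ℕ.* a i k) ≡ d i k ℕ.* (i ℕ.+ k ℕ.+ k)
  d-absorb zero    k = solve 1 (λ k → con 2 :* (k :* con 1) := con 1 :* (k :+ k)) refl k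
  d-absorb (suc i) k = begin
    2 ℕ.* (suc (i ℕ.+ k) ℕ.* p)
      ≡⟨ solve 3 (λ i k p → con 2 :* ((con 1 :+ (i :+ k)) :* p) :=
           p :* (con 1 :+ (i :+ k :+ k)) :+ (con 1 :+ i) :* p) refl i k p ⟩
    p ℕ.* suc N ℕ.+ suc i ℕ.* p
      ≡⟨ cong (p ℕ.* suc N ℕ.+_) ([k+1]*[n+1]C[k+1]≡[n+1]*nCk N i) ⟩
    p ℕ.* suc N ℕ.+ suc N ℕ.* a i k
      ≡⟨ cong (p ℕ.* suc N ℕ.+_) (ℕ.*-comm (suc N) (a i k)) ⟩
    p ℕ.* suc N ℕ.+ a i k ℕ.* suc N
      ≡⟨ ℕ.*-distribʳ-+ (suc N) p (a i k) ⟨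
    (p ℕ.+ a i k) ℕ.* suc N ∎
    where
    N = i ℕ.+ k ℕ.+ k
    p = a (suc i) k

-- Sums over the antidiagonal i + k = n

open CommutativeRing ℚ√5-commutativeRing
  using (semiring; commutativeSemiring; +-commutativeMonoid; +-assoc; *-identityʳ)
open MonoidSum +-commutativeMonoid using (∑-distrib-+)
open SemiringSum semiring using (*-distribˡ-sum)
open SemiringExp semiring using (^-assocʳ)
open CommutativeSemiringExp commutativeSemiring using (^-distrib-*)

-- Summands depend on `i` and `k` separately, which keeps truncated subtraction out of the later
-- algebra. Splitting off the term `k = 0` and shifting `k` holds by computation.
convolution : (ℕ → ℕ → ℚ√5) → ℕ → ℚ√5
convolution f n = ∑[k≤ n ] λ k → f (n ℕ.∸ k) k

convolution-cong : ∀ {f g} n → (∀ i k → i ℕ.+ k ≡ n → f i k ≡ g i k) →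
  convolution f n ≡ convolution g n
convolution-cong zero    f≗g = cong (_+ 0#) (f≗g 0 0 refl)
convolution-cong (suc n) f≗g = cong₂ _+_ (f≗g (suc n) 0 (ℕ.+-identityʳ (suc n)))
  (convolution-cong n (λ i k e → f≗g i (suc k) (trans (ℕ.+-suc i k) (cong suc e))))

convolution-* : ∀ x f n → convolution (λ i k → x * f i k) n ≡ x * convolution f n
convolution-* x f n = sym (*-distribˡ-sum {suc n} x (λ k → f (n ℕ.∸ toℕ k) (toℕ k)))

convolution-+* : ∀ f x g n →
  convolution (λ i k → f i k + x * g i k) n ≡ convolution f n + x * convolution g n
convolution-+* f x g n = trans
  (∑-distrib-+ {suc n} (λ k → f (n ℕ.∸ toℕ k) (toℕ k)) (λ k → x * g (n ℕ.∸ toℕ k) (toℕ k)))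
  (cong (λ z → convolution f n + z) (convolution-* x g n))

-- The split at the other end: the term `i = 0` is removed and `i` is shifted in the rest.
convolution-∷ʳ : ∀ f n →
  convolution f (suc n) ≡ convolution (λ i → f (suc i)) n + f 0 (suc n)
convolution-∷ʳ f zero    = solve 2 (λ x y → x :+ (y :+ con 0#) := (x :+ con 0#) :+ y) refl (f 1 0) (f 0 1)
  where open ℚ√5-Solver
convolution-∷ʳ f (suc n) = begin
  f (suc (suc n)) 0 + convolution (λ i k → f i (suc k)) (suc n)
    ≡⟨ cong (λ z → f (suc (suc n)) 0 + z) (convolution-∷ʳ (λ i k → f i (suc k)) n) ⟩
  f (suc (suc n)) 0 + (convolution (λ i k → f (suc i) (suc k)) n + f 0 (suc (suc n)))
    ≡⟨ +-assoc (f (suc (suc n)) 0) (convolution (λ i k → f (suc i) (suc k)) n) (f 0 (suc (suc n))) ⟨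
  convolution (λ i → f (suc i)) (suc n) + f 0 (suc (suc n)) ∎

module MorganVoyce (x : ℚ√5) where

  open ℚ√5-Solver

  term : (ℕ → ℕ → ℕ) → ℕ → ℕ → ℚ√5
  term c i k = (- 1#) ^ i * fromℕ (c i k) * x ^ k

  A B : ℕ → ℚ√5
  A = convolution (term a)
  B = convolution (term b)

  -- Lifts a Pascal-type relation from coefficients to polynomials. Shifting `i` by one flips the
  -- sign of the `c″` part, and `c″` contributes nothing at `i = 0`. It yields both the recurrence
  -- for B and the expression of the sum by A.
  convolution-telescope : ∀ c c′ c″ → (∀ k → c 0 k ≡ c′ 0 k) →
    (∀ i k → c (suc i) k ≡ c′ (suc i) k ℕ.+ c″ i k) → ∀ n →
    convolution (term c) (suc n) ≡ convolution (term c′) (suc n) + - convolution (term c″) n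
  convolution-telescope c c′ c″ c₀ c₊ n = begin
    convolution (term c) (suc n)
      ≡⟨ convolution-∷ʳ (term c) n ⟩
    convolution (λ i → term c (suc i)) n + term c 0 (suc n)
      ≡⟨ cong₂ _+_ (convolution-cong n (λ i k _ → step i k))
           (cong (λ l → 1# * fromℕ l * x ^ suc n) (c₀ (suc n))) ⟩
    convolution (λ i k → term c′ (suc i) k + - 1# * term c″ i k) n + term c′ 0 (suc n)
      ≡⟨ cong (_+ term c′ 0 (suc n))
           (convolution-+* (λ i → term c′ (suc i)) (- 1#) (term c″) n) ⟩
    convolution (λ i → term c′ (suc i)) n + - 1# * convolution (term c″) n + term c′ 0 (suc n)
      ≡⟨ solve 3 (λ p q r → p :+ con (- 1#) :* q :+ r := (p :+ r) :- q) refl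
           (convolution (λ i → term c′ (suc i)) n) (convolution (term c″) n) (term c′ 0 (suc n)) ⟩
    (convolution (λ i → term c′ (suc i)) n + term c′ 0 (suc n)) + - convolution (term c″) n
      ≡⟨ cong (_+ - convolution (term c″) n) (convolution-∷ʳ (term c′) n) ⟨
    convolution (term c′) (suc n) + - convolution (term c″) n ∎
    where
    step : ∀ i k → term c (suc i) k ≡ term c′ (suc i) k + - 1# * term c″ i k
    step i k = trans
      (cong (λ l → (- 1#) ^ suc i * l * x ^ k)
        (trans (cong fromℕ (c₊ i k)) (fromℤ-+ (+ c′ (suc i) k) (+ c″ i k))))
      (solve 4 (λ s p q y → con (- 1#) :* s :* (p :+ q) :* y :=
                  con (- 1#) :* s :* p :* y :+ con (- 1#) :* (s :* q :* y))
        refl ((- 1#) ^ i) (fromℕ (c′ (suc i) k)) (fromℕ (c″ i k)) (x ^ k))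

  B-step : ∀ n → B (suc n) ≡ A (suc n) + - B n
  B-step = convolution-telescope b a b (λ _ → refl) b-pascal

  A-step : ∀ n → A (suc n) ≡ x * B n + - A n
  A-step zero = solve 1 (λ x →
    con (- 1#) :* con 1# :* con 1# :* con 1# :+ (con 1# :* con 1# :* (x :* con 1#) :+ con 0#)
    := x :* (con 1# :* con 1# :* con 1# :+ con 0#) :- (con 1# :* con 1# :* con 1# :+ con 0#)) refl x
  A-step (suc n) = begin
    term a (suc (suc n)) 0 + convolution (λ i k → term a i (suc k)) (suc n)
      -- The constant terms alternate between 1 and -1, and x times B has none, so `k = 0` is
      -- treated apart from the positive powers of x.
      ≡⟨ cong₂ _+_ head tail ⟩
    - term a (suc n) 0 + (x * B (suc n) + - 1# * convolution (λ i k → term a i (suc k)) n)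
      ≡⟨ solve 3 (λ p q r → (:- p) :+ (q :+ con (- 1#) :* r) := q :- (p :+ r)) refl
           (term a (suc n) 0) (x * B (suc n)) (convolution (λ i k → term a i (suc k)) n) ⟩
    x * B (suc n) + - A (suc n) ∎
    where
    head : term a (suc (suc n)) 0 ≡ - term a (suc n) 0
    head = trans (cong (λ l → (- 1#) ^ suc (suc n) * fromℕ l * 1#) (trans (aᵢ₀≡1 (suc (suc n))) (sym (aᵢ₀≡1 (suc n)))))
      (solve 2 (λ s l → con (- 1#) :* s :* l :* con 1# := :- (s :* l :* con 1#)) refl
        ((- 1#) ^ suc n) (fromℕ (a (suc n) 0)))

    step : ∀ i k → term a (suc i) (suc k) ≡ x * term b (suc i) k + - 1# * term a i (suc k)
    step i k = trans
      (cong (λ l → (- 1#) ^ suc i * l * x ^ suc k)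
        (trans (cong fromℕ (a-pascal i k)) (fromℤ-+ (+ b (suc i) k) (+ a i (suc k)))))
      (solve 5 (λ x s p q y → con (- 1#) :* s :* (p :+ q) :* (x :* y) :=
                  x :* (con (- 1#) :* s :* p :* y) :+ con (- 1#) :* (s :* q :* (x :* y)))
        refl x ((- 1#) ^ i) (fromℕ (b (suc i) k)) (fromℕ (a i (suc k))) (x ^ k))

    tail : convolution (λ i k → term a i (suc k)) (suc n)
         ≡ x * B (suc n) + - 1# * convolution (λ i k → term a i (suc k)) n
    tail = begin
      convolution (λ i k → term a i (suc k)) (suc n)
        ≡⟨ convolution-∷ʳ (λ i k → term a i (suc k)) n ⟩
      convolution (λ i k → term a (suc i) (suc k)) n + term a 0 (suc (suc n))
        ≡⟨ cong (_+ term a 0 (suc (suc n))) (trans (convolution-cong n (λ i k _ → step i k))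
             (trans (convolution-+* (λ i k → x * term b (suc i) k) (- 1#) (λ i k → term a i (suc k)) n)
               (cong (λ z → z + - 1# * T) (convolution-* x (λ i → term b (suc i)) n)))) ⟩
      x * convolution (λ i → term b (suc i)) n + - 1# * T + 1# * 1# * (x * x ^ suc n)
        -- The power of x left over at `i = 0` is x times the `i = 0` term of `B (suc n)`, which
        -- completes that sum.
        ≡⟨ solve 4 (λ x p q y → x :* p :+ q :+ con 1# :* con 1# :* (x :* y) := x :* (p :+ con 1# :* con 1# :* y) :+ q)
             refl x (convolution (λ i → term b (suc i)) n) (- 1# * T) (x ^ suc n) ⟩
      x * (convolution (λ i → term b (suc i)) n + term b 0 (suc n)) + - 1# * T
        ≡⟨ cong (λ z → x * z + - 1# * T) (convolution-∷ʳ (term b) n) ⟨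
      x * B (suc n) + - 1# * T ∎
      where T = convolution (λ i k → term a i (suc k)) n

  S≡½*ΔA : ∀ n → S (suc n) x ≡ fromℚ ½ * (A (suc n) + - A n)
  S≡½*ΔA n = begin
    S (suc n) x
      -- `S (suc n) x` unfolds to a convolution in which n - k has become `i`; agreement is needed
      -- only where `i + k` equals `suc n`.
      ≡⟨ convolution-cong {λ i k → (- 1#) ^ i * fromℚ (+ suc n ℚ./ (suc n ℕ.+ k)) * fromℤ (+ ((suc n ℕ.+ k) C i)) * x ^ k} {λ i k → fromℚ ½ * term d i k} (suc n) coefficient ⟩
    convolution (λ i k → fromℚ ½ * term d i k) (suc n)
      ≡⟨ convolution-* (fromℚ ½) (term d) (suc n) ⟩
    fromℚ ½ * convolution (term d) (suc n)
      ≡⟨ cong (fromℚ ½ *_) (convolution-telescope d a a (λ _ → refl) (λ _ _ → refl) n) ⟩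
    fromℚ ½ * (A (suc n) + - A n) ∎
    where
    coefficient : ∀ i k → i ℕ.+ k ≡ suc n →
      (- 1#) ^ i * fromℚ (+ suc n ℚ./ (suc n ℕ.+ k)) * fromℤ (+ ((suc n ℕ.+ k) C i)) * x ^ k
        ≡ fromℚ ½ * term d i k
    coefficient i k i+k≡1+n = begin
      (- 1#) ^ i * q * c * x ^ k
        ≡⟨ solve 4 (λ s q c y → s :* q :* c :* y := s :* (q :* c) :* y) refl ((- 1#) ^ i) q c (x ^ k) ⟩
      (- 1#) ^ i * (q * c) * x ^ k
        ≡⟨ cong (λ z → (- 1#) ^ i * z * x ^ k)
             (fromℚ-½ (suc n) ((suc n ℕ.+ k) C i) (d i k) (suc n ℕ.+ k)
               (subst (λ m → 2 ℕ.* (m ℕ.* ((m ℕ.+ k) C i)) ≡ d i k ℕ.* (m ℕ.+ k)) i+k≡1+n (d-absorb i k))) ⟩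
      (- 1#) ^ i * (fromℚ ½ * fromℕ (d i k)) * x ^ k
        ≡⟨ solve 4 (λ s h e y → s :* (h :* e) :* y := h :* (s :* e :* y)) refl ((- 1#) ^ i) (fromℚ ½) (fromℕ (d i k)) (x ^ k) ⟩
      fromℚ ½ * term d i k ∎
      where
      q = fromℚ (+ suc n ℚ./ (suc n ℕ.+ k))
      c = fromℤ (+ ((suc n ℕ.+ k) C i))

-- Power sums of two mutually inverse elements

module _ (t u : ℚ√5) (t*u≡1 : t * u ≡ 1#) where

  open ℚ√5-Solver
  open MorganVoyce (fromℤ (+ 2) + (t + u))

  ΔA : ℕ → ℚ√5
  ΔA n = A (suc n) + - A n

  A-recurrence : ∀ n → A (suc (suc n)) ≡ (t + u) * A (suc n) + - A n
  A-recurrence n = begin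
    A (suc (suc n))                  ≡⟨ A-step (suc n) ⟩
    x * B (suc n) + - A (suc n)      ≡⟨ cong (λ z → x * z + - A (suc n)) (B-step n) ⟩
    x * (A (suc n) + - B n) + - A (suc n)
      -- The terms are regrouped so that `B n` occurs only in x Bₙ - Aₙ, which `A-step` identifies
      -- with Aₙ₊₁; the second bracket then cancels.
      ≡⟨ solve 4 (λ y a a′ b → (con (fromℤ (+ 2)) :+ y) :* (a :- b) :- a :=
                   (y :* a :- a′) :+ (a :- ((con (fromℤ (+ 2)) :+ y) :* b :- a′)))
           refl (t + u) (A (suc n)) (A n) (B n) ⟩
    ((t + u) * A (suc n) + - A n) + (A (suc n) + - (x * B n + - A n))
      ≡⟨ cong (λ z → ((t + u) * A (suc n) + - A n) + (A (suc n) + - z)) (A-step n) ⟨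
    ((t + u) * A (suc n) + - A n) + (A (suc n) + - A (suc n))
      ≡⟨ solve 2 (λ p q → p :+ (q :- q) := p) refl ((t + u) * A (suc n) + - A n) (A (suc n)) ⟩
    (t + u) * A (suc n) + - A n ∎
    where x = fromℤ (+ 2) + (t + u)

  ΔA-recurrence : ∀ n → ΔA (suc n) ≡ (t + u) * A (suc n) + - A n + - A (suc n)
  ΔA-recurrence n = cong (_+ - A (suc n)) (A-recurrence n)

  -- The right side is the form to which `t ^ 1 + u ^ 1` unfolds.
  ΔA₀ : ΔA 0 ≡ t * 1# + u * 1#
  ΔA₀ = trans (cong (_+ - A 0) (A-step 0))
    (solve 2 (λ t u → (con (fromℤ (+ 2)) :+ (t :+ u)) :* con 1# :- con 1# :- con 1# := t :* con 1# :+ u :* con 1#) refl t u)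

  ΔA₁ : ΔA 1 ≡ t * (t * 1#) + u * (u * 1#)
  ΔA₁ = begin
    ΔA 1 ≡⟨ ΔA-recurrence 0 ⟩
    (t + u) * A 1 + - A 0 + - A 1
      ≡⟨ cong (λ z → (t + u) * z + - A 0 + - z) (A-step 0) ⟩
    (t + u) * ((fromℤ (+ 2) + (t + u)) * 1# + - 1#) + - 1# + - ((fromℤ (+ 2) + (t + u)) * 1# + - 1#)
      -- The deviation from t² + u² is isolated as 2(tu - 1), which vanishes.
      ≡⟨ solve 2 (λ t u → let z = (con (fromℤ (+ 2)) :+ (t :+ u)) :* con 1# :- con 1# in
           (t :+ u) :* z :- con 1# :- z :=
           t :* (t :* con 1#) :+ u :* (u :* con 1#) :+ con (fromℤ (+ 2)) :* (t :* u :- con 1#)) refl t u ⟩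
    t * (t * 1#) + u * (u * 1#) + fromℤ (+ 2) * (t * u + - 1#)
      ≡⟨ cong (λ z → t * (t * 1#) + u * (u * 1#) + fromℤ (+ 2) * (z + - 1#)) t*u≡1 ⟩
    t * (t * 1#) + u * (u * 1#) + 0#
      ≡⟨ solve 1 (λ z → z :+ con 0# := z) refl (t * (t * 1#) + u * (u * 1#)) ⟩
    t * (t * 1#) + u * (u * 1#) ∎

  -- As tu = 1, both t and u are roots of z² - (t+u)z + 1, so the power sums obey the same
  -- second-order recurrence as `ΔA`.
  power-sum-step : ∀ n → ΔA n ≡ t ^ suc n + u ^ suc n →
    ΔA (suc n) ≡ t ^ suc (suc n) + u ^ suc (suc n) →
    ΔA (suc (suc n)) ≡ t ^ suc (suc (suc n)) + u ^ suc (suc (suc n))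
  power-sum-step n e₀ e₁ = begin
    ΔA (suc (suc n))
      ≡⟨ ΔA-recurrence (suc n) ⟩
    (t + u) * A (suc (suc n)) + - A (suc n) + - A (suc (suc n))
      ≡⟨ cong (λ z → (t + u) * A (suc (suc n)) + - A (suc n) + - z) (A-recurrence n) ⟩
    (t + u) * A (suc (suc n)) + - A (suc n) + - ((t + u) * A (suc n) + - A n)
      ≡⟨ solve 4 (λ y p q r → y :* p :- q :- (y :* q :- r) := y :* (p :- q) :- (q :- r)) refl
           (t + u) (A (suc (suc n))) (A (suc n)) (A n) ⟩
    (t + u) * ΔA (suc n) + - ΔA n
      ≡⟨ cong₂ (λ p q → (t + u) * p + - q) e₁ e₀ ⟩
    (t + u) * (t ^ suc (suc n) + u ^ suc (suc n)) + - (t ^ suc n + u ^ suc n)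
      ≡⟨ solve 4 (λ t u p q → (t :+ u) :* (t :* p :+ u :* q) :- (p :+ q) :=
            (t :* (t :* p) :+ u :* (u :* q)) :+ (t :* u :- con 1#) :* (p :+ q)) refl t u (t ^ suc n) (u ^ suc n) ⟩
    t ^ suc (suc (suc n)) + u ^ suc (suc (suc n)) + (t * u + - 1#) * (t ^ suc n + u ^ suc n)
      ≡⟨ cong (λ z → t ^ suc (suc (suc n)) + u ^ suc (suc (suc n)) + (z + - 1#) * (t ^ suc n + u ^ suc n)) t*u≡1 ⟩
    t ^ suc (suc (suc n)) + u ^ suc (suc (suc n)) + 0# * (t ^ suc n + u ^ suc n)
      ≡⟨ solve 2 (λ p q → p :+ con 0# :* q := p) refl (t ^ suc (suc (suc n)) + u ^ suc (suc (suc n))) (t ^ suc n + u ^ suc n) ⟩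
    t ^ suc (suc (suc n)) + u ^ suc (suc (suc n)) ∎

  ΔA≡t^+u^ : ∀ n → ΔA n ≡ t ^ suc n + u ^ suc n
  ΔA≡t^+u^ 0             = ΔA₀
  ΔA≡t^+u^ 1             = ΔA₁
  ΔA≡t^+u^ (suc (suc n)) = power-sum-step n (ΔA≡t^+u^ n) (ΔA≡t^+u^ (suc n))

  S[2+t+u]≡½[tⁿ+uⁿ] : ∀ n .{{_ : NonZero n}} →
    S n (fromℤ (+ 2) + (t + u)) ≡ fromℚ ½ * (t ^ n + u ^ n)
  S[2+t+u]≡½[tⁿ+uⁿ] (suc n) = trans (S≡½*ΔA n) (cong (fromℚ ½ *_) (ΔA≡t^+u^ n))

-- Binet's formulas and parity

α β : ℚ√5
α = ½ +√5 ½
β = ½ +√5 (ℚ.- ½)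

module _ where
  open ℚ√5-Solver

  -- Both α and β satisfy z² = z + 1, which the solver checks on the constants, so the left side
  -- obeys the Lucas recurrence.
  binet-lucas : ∀ n → α ^ n + β ^ n ≡ fromℕ (lucas n)
  binet-lucas 0 = refl
  binet-lucas 1 = refl
  binet-lucas (suc (suc n)) = begin
    α ^ suc (suc n) + β ^ suc (suc n)
      ≡⟨ solve 2 (λ a b → con α :* (con α :* a) :+ con β :* (con β :* b) :=
           (con α :* a :+ con β :* b) :+ (a :+ b)) refl (α ^ n) (β ^ n) ⟩
    (α ^ suc n + β ^ suc n) + (α ^ n + β ^ n)
      ≡⟨ cong₂ _+_ (binet-lucas (suc n)) (binet-lucas n) ⟩
    fromℕ (lucas (suc n)) + fromℕ (lucas n)
      ≡⟨ fromℤ-+ (+ lucas (suc n)) (+ lucas n) ⟨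
    fromℕ (lucas (suc (suc n))) ∎

  binet-fib : ∀ n → α ^ n + - β ^ n ≡ √5 * fromℕ (fib n)
  binet-fib 0 = refl
  binet-fib 1 = refl
  binet-fib (suc (suc n)) = begin
    α ^ suc (suc n) + - β ^ suc (suc n)
      ≡⟨ solve 2 (λ a b → con α :* (con α :* a) :- con β :* (con β :* b) :=
           (con α :* a :- con β :* b) :+ (a :- b)) refl (α ^ n) (β ^ n) ⟩
    (α ^ suc n + - β ^ suc n) + (α ^ n + - β ^ n)
      ≡⟨ cong₂ _+_ (binet-fib (suc n)) (binet-fib n) ⟩
    √5 * fromℕ (fib (suc n)) + √5 * fromℕ (fib n)
      ≡⟨ *-distribˡ-+ √5 (fromℕ (fib (suc n))) (fromℕ (fib n)) ⟨
    √5 * (fromℕ (fib (suc n)) + fromℕ (fib n))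
      ≡⟨ cong (√5 *_) (fromℤ-+ (+ fib (suc n)) (+ fib n)) ⟨
    √5 * fromℕ (fib (suc (suc n))) ∎

  -- The product `α * β` evaluates to `- 1#`.
  α^*β^ : ∀ n → α ^ n * β ^ n ≡ (- 1#) ^ n
  α^*β^ n = sym (^-distrib-* α β n)

  -- Makes the choice of sign a factor, so that its powers can be taken.
  ±≡±1* : ∀ s x → ±[ s ] x ≡ ±[ s ] 1# * x
  ±≡±1* Sign.+ x = sym (*-identityˡ x)
  ±≡±1* Sign.- x = solve 1 (λ x → :- x := con (- 1#) :* x) refl x

±1*±1≡1 : ∀ s → ±[ s ] 1# * ±[ s ] 1# ≡ 1#
±1*±1≡1 Sign.+ = refl
±1*±1≡1 Sign.- = refl

^-even : ∀ x → x * x ≡ 1# → ∀ {n} → 2 ℕ∣.∣ n → x ^ n ≡ 1#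
^-even x x²≡1 (divides q refl) = helper q
  where
  helper : ∀ q → x ^ (q ℕ.* 2) ≡ 1#
  helper zero    = refl
  helper (suc q) = begin
    x * (x * x ^ (q ℕ.* 2))  ≡⟨ cong (λ y → x * (x * y)) (helper q) ⟩
    x * (x * 1#)             ≡⟨ cong (x *_) (*-identityʳ x) ⟩
    x * x                    ≡⟨ x²≡1 ⟩
    1#                       ∎

2∤n⇒2∣n∸1 : ∀ n → ¬ 2 ℕ∣.∣ n → ∃[ m ] n ≡ suc m × 2 ℕ∣.∣ m
2∤n⇒2∣n∸1 zero          2∤0   = ⊥-elim (2∤0 (divides 0 refl))
2∤n⇒2∣n∸1 (suc zero)    _     = 0 , refl , divides 0 refl
2∤n⇒2∣n∸1 (suc (suc n)) 2∤2+n with 2∤n⇒2∣n∸1 n (2∤2+n ∘ λ (divides q e) → divides (suc q) (cong (2 ℕ.+_) e))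
... | m , refl , divides q e = suc (suc m) , refl , divides (suc q) (cong (2 ℕ.+_) e)

^-odd : ∀ x → x * x ≡ 1# → ∀ {n} → ¬ 2 ℕ∣.∣ n → x ^ n ≡ x
^-odd x x²≡1 {n} 2∤n with 2∤n⇒2∣n∸1 n 2∤n
... | m , refl , 2∣m = trans (cong (x *_) (^-even x x²≡1 2∣m)) (*-identityʳ x)

2∤m*n : ∀ {m n} → ¬ 2 ℕ∣.∣ m → ¬ 2 ℕ∣.∣ n → ¬ 2 ℕ∣.∣ m ℕ.* n
2∤m*n {m} {n} 2∤m 2∤n = [ 2∤m , 2∤n ]′ ∘ euclidsLemma m n prime[2]

-1ℤ^even : ∀ {n} → 2 ℕ∣.∣ n → -1ℤ ℤ.^ n ≡ + 1
-1ℤ^even (divides q refl) = trans (cong (-1ℤ ℤ.^_) (ℕ.*-comm q 2))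
  (trans (sym (ℤ.^-*-assoc -1ℤ 2 q)) (ℤ.^-zeroˡ q))

-- The sign (-1)ʲ in L₋ⱼ is 1 for even j, so the index may be replaced by its absolute value, where
-- Binet's formula applies.
L-even : ∀ i → 2 ℕ∣.∣ ℤ.∣ i ∣ → L i ≡ + lucas ℤ.∣ i ∣
L-even (+ n)    _   = refl
L-even -[1+ n ] 2∣i = trans (cong (ℤ._* + lucas (suc n)) (-1ℤ^even 2∣i)) (ℤ.*-identityˡ _)

-- The sign in F₋ⱼ has exponent j - 1, so here it is odd j that makes it 1.
F-odd : ∀ i → ¬ 2 ℕ∣.∣ ℤ.∣ i ∣ → F i ≡ + fib ℤ.∣ i ∣
F-odd (+ n)    _   = refl
F-odd -[1+ n ] 2∤i with 2∤n⇒2∣n∸1 (suc n) 2∤i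
... | _ , refl , 2∣n = trans (cong (ℤ._* + fib (suc n)) (-1ℤ^even 2∣n)) (ℤ.*-identityˡ _)

-- The identities for an index of given parity

module _ (n : ℕ) .{{_ : NonZero n}} (i : ℤ) (s : Sign) where

  open ℚ√5-Solver

  private
    j = ℤ.∣ i ∣
    σ = ±[ s ] 1#

  ∣i*n∣ : ℤ.∣ i ℤ.* + n ∣ ≡ j ℕ.* n
  ∣i*n∣ = ℤ.abs-* i (+ n)

  -- Take t = σαʲ and u = σβʲ. Then tu = σ²(αβ)ʲ = (-1)ʲ, which is 1 for even j, and t + u is σ
  -- times a Lucas number by Binet.
  S-L : 2 ℕ∣.∣ j →
    S n (fromℤ (+ 2) + ±[ s ] fromℤ (L i)) ≡ σ ^ n * fromℚ ½ * fromℤ (L (i ℤ.* + n))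
  S-L 2∣j = begin
    S n (fromℤ (+ 2) + ±[ s ] fromℤ (L i))
      ≡⟨ cong (λ z → S n (fromℤ (+ 2) + z)) t+u ⟨
    S n (fromℤ (+ 2) + (σ * α ^ j + σ * β ^ j))
      ≡⟨ S[2+t+u]≡½[tⁿ+uⁿ] (σ * α ^ j) (σ * β ^ j) t*u n ⟩
    fromℚ ½ * ((σ * α ^ j) ^ n + (σ * β ^ j) ^ n)
      ≡⟨ cong (fromℚ ½ *_) (cong₂ _+_ (power α) (power β)) ⟩
    fromℚ ½ * (σ ^ n * α ^ (j ℕ.* n) + σ ^ n * β ^ (j ℕ.* n))
      ≡⟨ solve 4 (λ h s a b → h :* (s :* a :+ s :* b) := s :* h :* (a :+ b)) refl
           (fromℚ ½) (σ ^ n) (α ^ (j ℕ.* n)) (β ^ (j ℕ.* n)) ⟩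
    σ ^ n * fromℚ ½ * (α ^ (j ℕ.* n) + β ^ (j ℕ.* n))
      ≡⟨ cong (σ ^ n * fromℚ ½ *_) (binet-lucas (j ℕ.* n)) ⟩
    σ ^ n * fromℚ ½ * fromℕ (lucas (j ℕ.* n))
      ≡⟨ cong (λ l → σ ^ n * fromℚ ½ * fromℕ (lucas l)) ∣i*n∣ ⟨
    σ ^ n * fromℚ ½ * fromℕ (lucas ℤ.∣ i ℤ.* + n ∣)
      ≡⟨ cong (λ l → σ ^ n * fromℚ ½ * fromℤ l)
           (L-even (i ℤ.* + n) (subst (2 ℕ∣.∣_) (sym ∣i*n∣) (ℕ∣.∣m⇒∣m*n n 2∣j))) ⟨
    σ ^ n * fromℚ ½ * fromℤ (L (i ℤ.* + n)) ∎
    where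
    power : ∀ x → (σ * x ^ j) ^ n ≡ σ ^ n * x ^ (j ℕ.* n)
    power x = trans (^-distrib-* σ (x ^ j) n) (cong (σ ^ n *_) (^-assocʳ x j n))

    t*u : (σ * α ^ j) * (σ * β ^ j) ≡ 1#
    t*u = begin
      (σ * α ^ j) * (σ * β ^ j)
        ≡⟨ solve 3 (λ s a b → (s :* a) :* (s :* b) := (s :* s) :* (a :* b)) refl σ (α ^ j) (β ^ j) ⟩
      (σ * σ) * (α ^ j * β ^ j)
        ≡⟨ cong₂ _*_ (±1*±1≡1 s) (trans (α^*β^ j) (^-even (- 1#) refl 2∣j)) ⟩
      1# ∎

    t+u : σ * α ^ j + σ * β ^ j ≡ ±[ s ] fromℤ (L i)
    t+u = begin
      σ * α ^ j + σ * β ^ j  ≡⟨ *-distribˡ-+ σ (α ^ j) (β ^ j) ⟨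
      σ * (α ^ j + β ^ j)    ≡⟨ cong (σ *_) (binet-lucas j) ⟩
      σ * fromℕ (lucas j)    ≡⟨ cong (λ l → σ * fromℤ l) (L-even i 2∣j) ⟨
      σ * fromℤ (L i)        ≡⟨ ±≡±1* s (fromℤ (L i)) ⟨
      ±[ s ] fromℤ (L i)     ∎

  -- Take t = σαʲ and u = -σβʲ. Then tu = -(αβ)ʲ = 1 for odd j, and t + u is σ√5 times a Fibonacci
  -- number. As n is odd, σ and -σ equal their own n-th powers, so the n-th power sum is again a
  -- difference of Binet type.
  S-F : ¬ 2 ℕ∣.∣ j → ¬ 2 ℕ∣.∣ n →
    S n (fromℤ (+ 2) + ±[ s ] (√5 * fromℤ (F i))) ≡ ±[ s ] (√5 * fromℚ ½ * fromℤ (F (i ℤ.* + n)))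
  S-F 2∤j 2∤n = begin
    S n (fromℤ (+ 2) + ±[ s ] (√5 * fromℤ (F i)))
      ≡⟨ cong (λ z → S n (fromℤ (+ 2) + z)) t+u ⟨
    S n (fromℤ (+ 2) + (σ * α ^ j + (- σ) * β ^ j))
      ≡⟨ S[2+t+u]≡½[tⁿ+uⁿ] (σ * α ^ j) ((- σ) * β ^ j) t*u n ⟩
    fromℚ ½ * ((σ * α ^ j) ^ n + ((- σ) * β ^ j) ^ n)
      ≡⟨ cong (fromℚ ½ *_) (cong₂ _+_ (power σ (±1*±1≡1 s) α) (power (- σ) -σ*-σ≡1 β)) ⟩
    fromℚ ½ * (σ * α ^ (j ℕ.* n) + (- σ) * β ^ (j ℕ.* n))
      ≡⟨ solve 4 (λ h s a b → h :* (s :* a :+ (:- s) :* b) := s :* (h :* (a :- b))) refl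
           (fromℚ ½) σ (α ^ (j ℕ.* n)) (β ^ (j ℕ.* n)) ⟩
    σ * (fromℚ ½ * (α ^ (j ℕ.* n) + - β ^ (j ℕ.* n)))
      ≡⟨ cong (λ z → σ * (fromℚ ½ * z)) (binet-fib (j ℕ.* n)) ⟩
    σ * (fromℚ ½ * (√5 * fromℕ (fib (j ℕ.* n))))
      ≡⟨ cong (λ l → σ * (fromℚ ½ * (√5 * fromℕ (fib l)))) ∣i*n∣ ⟨
    σ * (fromℚ ½ * (√5 * fromℕ (fib ℤ.∣ i ℤ.* + n ∣)))
      ≡⟨ cong (λ l → σ * (fromℚ ½ * (√5 * fromℤ l)))
           (F-odd (i ℤ.* + n) (subst (λ l → ¬ 2 ℕ∣.∣ l) (sym ∣i*n∣) (2∤m*n {j} 2∤j 2∤n))) ⟨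
    σ * (fromℚ ½ * (√5 * fromℤ (F (i ℤ.* + n))))
      ≡⟨ solve 4 (λ s h r f → s :* (h :* (r :* f)) := s :* (r :* h :* f)) refl
           σ (fromℚ ½) √5 (fromℤ (F (i ℤ.* + n))) ⟩
    σ * (√5 * fromℚ ½ * fromℤ (F (i ℤ.* + n)))
      ≡⟨ ±≡±1* s (√5 * fromℚ ½ * fromℤ (F (i ℤ.* + n))) ⟨
    ±[ s ] (√5 * fromℚ ½ * fromℤ (F (i ℤ.* + n))) ∎
    where
    -σ*-σ≡1 : (- σ) * (- σ) ≡ 1#
    -σ*-σ≡1 = trans (solve 1 (λ s → (:- s) :* (:- s) := s :* s) refl σ) (±1*±1≡1 s)

    power : ∀ c → c * c ≡ 1# → ∀ x → (c * x ^ j) ^ n ≡ c * x ^ (j ℕ.* n)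
    power c c²≡1 x = trans (^-distrib-* c (x ^ j) n) (cong₂ _*_ (^-odd c c²≡1 2∤n) (^-assocʳ x j n))

    t*u : (σ * α ^ j) * ((- σ) * β ^ j) ≡ 1#
    t*u = begin
      (σ * α ^ j) * ((- σ) * β ^ j)
        ≡⟨ solve 3 (λ s a b → (s :* a) :* ((:- s) :* b) := (s :* s) :* (:- (a :* b))) refl σ (α ^ j) (β ^ j) ⟩
      (σ * σ) * (- (α ^ j * β ^ j))
        ≡⟨ cong₂ (λ y z → y * (- z)) (±1*±1≡1 s) (trans (α^*β^ j) (^-odd (- 1#) refl 2∤j)) ⟩
      1# ∎

    t+u : σ * α ^ j + (- σ) * β ^ j ≡ ±[ s ] (√5 * fromℤ (F i))
    t+u = begin
      σ * α ^ j + (- σ) * β ^ j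
        ≡⟨ solve 3 (λ s a b → s :* a :+ (:- s) :* b := s :* (a :- b)) refl σ (α ^ j) (β ^ j) ⟩
      σ * (α ^ j + - β ^ j)        ≡⟨ cong (σ *_) (binet-fib j) ⟩
      σ * (√5 * fromℕ (fib j))     ≡⟨ cong (λ l → σ * (√5 * fromℤ l)) (F-odd i 2∤j) ⟨
      σ * (√5 * fromℤ (F i))       ≡⟨ ±≡±1* s (√5 * fromℤ (F i)) ⟨
      ±[ s ] (√5 * fromℤ (F i))    ∎

theorem4 : (n : ℕ) .{{_ : NonZero n}} (m : ℕ) (p : ℤ) (s : Sign) →
    (¬ (+ 2 ℤ∣.∣ p) → ¬ (2 ℕ∣.∣ m) → ¬ (2 ℕ∣.∣ n) →
    S n (fromℤ (+ 2) + ±[ s ] (√5 * fromℤ (F (p ℤ.* + m))))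
    ≡ ±[ s ] (√5 * fromℚ ½ * fromℤ (F (p ℤ.* + m ℤ.* + n))))
    × (¬ (+ 2 ℤ∣.∣ p) → 2 ℕ∣.∣ m →
    S n (fromℤ (+ 2) + ±[ s ] fromℤ (L (p ℤ.* + m)))
    ≡ (±[ s ] 1#) ^ n * fromℚ ½ * fromℤ (L (p ℤ.* + m ℤ.* + n)))
    × (+ 2 ℤ∣.∣ p →
    S n (fromℤ (+ 2) + ±[ s ] fromℤ (L (p ℤ.* + m)))
    ≡ (±[ s ] 1#) ^ n * fromℚ ½ * fromℤ (L (p ℤ.* + m ℤ.* + n)))
theorem4 n m p s =
    -- Integer divisibility is divisibility of absolute values, so the parity of pm is read off
    -- |p|m; a product of odd numbers is odd because 2 is prime.
    (λ 2∤p 2∤m → S-F n i s (subst (λ l → ¬ 2 ℕ∣.∣ l) (sym ∣p*m∣) (2∤m*n {ℤ.∣ p ∣} 2∤p 2∤m)))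
  , (λ _ 2∣m → S-L n i s (subst (2 ℕ∣.∣_) (sym ∣p*m∣) (ℕ∣.∣n⇒∣m*n ℤ.∣ p ∣ 2∣m)))
  , (λ 2∣p → S-L n i s (subst (2 ℕ∣.∣_) (sym ∣p*m∣) (ℕ∣.∣m⇒∣m*n m 2∣p)))
  where
  i = p ℤ.* + m
  ∣p*m∣ : ℤ.∣ i ∣ ≡ ℤ.∣ p ∣ ℕ.* m
  ∣p*m∣ = ℤ.abs-* p (+ m)
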